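{- Let $a,b,m\in\mathbb{N}$ with $a\ge b$. If $a\equiv b\pmod m$, then $F_{a,b,m}(q)\in\mathbb{N}_0[[q]]$. More precisely, if $a=b+tm$ (with $t\in\mathbb{N}_0$), then $$F_{a,b,m}(q)=\frac{(-q^{a+b};q^m)_\infty}{(q^b;q^m)_t\,(q^{2a};q^{2m})_\infty}\in\mathbb{N}_0[[q]].$$
   Context: $\mathbb{N}$ is the set of positive integers and $\mathbb{N}_0=\mathbb{N}\cup\{0\}$. Notation: $(z;q)_n=\prod_{i=0}^{n-1}(1-zq^i)$ and $(z;q)_\infty=\prod_{i\ge0}(1-zq^i)$. For $a,b,m\in\mathbb{N}$, $$F_{a,b,m}(q):=\frac{(-q^{a+b};q^m)_\infty}{(-q^a;q^m)_\infty\,(q^b;q^m)_\infty},$$ regarded as a formal power series in $q$. $\mathbb{N}_0[[q]]$ is the set of power series with non-negative integer coefficients. -}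

module Defs where

open import Data.Fin.Base using (Fin; zero; suc; toℕ)
open import Data.Integer.Base as ℤ using (ℤ; 0ℤ; 1ℤ; _+_; _-_; _*_; -_; _≤_)
import Data.Integer.Properties as ℤ
open import Data.Integer.Tactic.RingSolver using (solve-∀)
open import Data.Nat.Base as ℕ using (ℕ; zero; suc; _∸_; z≤n; s≤s)
import Data.Nat.Properties as ℕ
open import Relation.Binary.PropositionalEquality

open import Algebra.Properties.Semiring.Sum ℤ.+-*-semiring
  using (sum; sum⁺-syntax; sum-cong-≗; sum-replicate-zero; ∑-distrib-+; ∑-comm; *-distribˡ-sum)

infixl 7 _*ₛ_ _/ₛ_
infixl 6 _-ₛ_
infix  8 -ₛ_
infixr 9 _^ₛ_
infix  4 _≈ₛ_ _∈ℕ₀⟦q⟧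

------------------------------------------------------------------------
-- The ring ℤ[[q]]; a series is its sequence of coefficients.

Series : Set
Series = ℕ → ℤ

_≈ₛ_ : Series → Series → Set
f ≈ₛ g = ∀ n → f n ≡ g n

_∈ℕ₀⟦q⟧ : Series → Set
f ∈ℕ₀⟦q⟧ = ∀ n → 0ℤ ≤ f n

1ₛ : Series
1ₛ zero    = 1ℤ
1ₛ (suc _) = 0ℤ

q : Series
q 1 = 1ℤ
q _ = 0ℤ

-ₛ_ : Series → Series
(-ₛ f) n = - f n

_-ₛ_ : Series → Series → Series
(f -ₛ g) n = f n - g n

_*ₛ_ : Series → Series → Series
(f *ₛ g) n = ∑[ i ≤ n ] (f (toℕ i) * g (n ∸ toℕ i))

_^ₛ_ : Series → ℕ → Series
f ^ₛ zero  = 1ₛ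
f ^ₛ suc n = f *ₛ f ^ₛ n

-- The multiplicative inverse of a series g with constant term 1, as the
-- geometric series Σₖ (1 - g)ᵏ, whose terms with k > n do not contribute to
-- the coefficient of qⁿ; see `inv-inverseʳ`.  When g 0 ≢ 1ℤ the value is
-- meaningless.
inv : Series → Series
inv g n = ∑[ k ≤ n ] ((1ₛ -ₛ g) ^ₛ toℕ k) n

_/ₛ_ : Series → Series → Series
f /ₛ g = f *ₛ inv g

------------------------------------------------------------------------
-- q-Pochhammer symbols

-- ⟪ z ⨾ w ⟫ n is (z;w)ₙ = ∏_{i<n} (1 - z wⁱ).
⟪_⨾_⟫ : Series → Series → ℕ → Series
⟪ z ⨾ w ⟫ zero    = 1ₛ
⟪ z ⨾ w ⟫ (suc n) = ⟪ z ⨾ w ⟫ n *ₛ (1ₛ -ₛ z *ₛ w ^ₛ n)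

-- (z;w)_∞, for a base w without constant term: the coefficient of qⁿ is the
-- same in all the partial products (z;w)ₖ with k > n; see `⟪⨾⟫-stable`.  When
-- w 0 ≢ 0ℤ the value is meaningless.
⟪_⨾_⟫∞ : Series → Series → Series
⟪ z ⨾ w ⟫∞ n = ⟪ z ⨾ w ⟫ (suc n) n

-- For a, b, m ≥ 1 the bases have no constant term and the denominator has
-- constant term 1.
F : ℕ → ℕ → ℕ → Series
F a b m = ⟪ -ₛ q ^ₛ (a ℕ.+ b) ⨾ q ^ₛ m ⟫∞
       /ₛ (⟪ -ₛ q ^ₛ a ⨾ q ^ₛ m ⟫∞ *ₛ ⟪ q ^ₛ b ⨾ q ^ₛ m ⟫∞)

------------------------------------------------------------------------
-- Correctness of the truncations in `inv` and `⟪_⨾_⟫∞`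

VanishesBelow : ℕ → Series → Set
VanishesBelow k f = ∀ {n} → n ℕ.< k → f n ≡ 0ℤ

∑-zero : ∀ n {t : Fin n → ℤ} → (∀ i → t i ≡ 0ℤ) → sum t ≡ 0ℤ
∑-zero n t≡0 = trans (sum-cong-≗ t≡0) (sum-replicate-zero n)

∑-extend : ∀ {m n} (t : ℕ → ℤ) → m ℕ.≤ n → (∀ {k} → m ℕ.< k → t k ≡ 0ℤ) →
           ∑[ k ≤ m ] t (toℕ k) ≡ ∑[ k ≤ n ] t (toℕ k)
∑-extend {n = n} t z≤n t≡0 = cong (t 0 +_) (sym (∑-zero n (λ _ → t≡0 (s≤s z≤n))))
∑-extend t (s≤s m≤n) t≡0 =
  cong (t 0 +_) (∑-extend (λ k → t (suc k)) m≤n (λ m<k → t≡0 (s≤s m<k)))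

∑-telescope : ∀ n (t : ℕ → ℤ) →
              ∑[ k ≤ n ] (t (toℕ k) - t (suc (toℕ k))) ≡ t 0 - t (suc n)
∑-telescope zero    t = ℤ.+-identityʳ _
∑-telescope (suc n) t =
  trans (cong (t 0 - t 1 +_) (∑-telescope n (λ k → t (suc k)))) (lemma (t 0) (t 1) _)
  where
  lemma : ∀ x y z → x - y + (y - z) ≡ x - z
  lemma = solve-∀

*ₛ-identityˡ : ∀ f → 1ₛ *ₛ f ≈ₛ f
*ₛ-identityˡ f n = trans (cong₂ _+_ (ℤ.*-identityˡ (f n)) (∑-zero n (λ _ → refl)))
                         (ℤ.+-identityʳ (f n))

*ₛ-identityʳ : ∀ f → f *ₛ 1ₛ ≈ₛ f
*ₛ-identityʳ f zero    = trans (ℤ.+-identityʳ _) (ℤ.*-identityʳ (f 0))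
*ₛ-identityʳ f (suc n) = trans (cong₂ _+_ (ℤ.*-zeroʳ (f 0)) (*ₛ-identityʳ (λ k → f (suc k)) n))
                               (ℤ.+-identityˡ _)

-ₛ-*ₛ-distribʳ : ∀ f g h → (f -ₛ g) *ₛ h ≈ₛ f *ₛ h -ₛ g *ₛ h
-ₛ-*ₛ-distribʳ f g h n = begin
  ((f -ₛ g) *ₛ h) n
    ≡⟨ sym (lemma₁ (((f -ₛ g) *ₛ h) n) ((g *ₛ h) n)) ⟩
  ((f -ₛ g) *ₛ h) n + (g *ₛ h) n - (g *ₛ h) n
    ≡⟨ cong (_- (g *ₛ h) n) (sym (∑-distrib-+ {suc n} (λ i → (f -ₛ g) (toℕ i) * h (n ∸ toℕ i))
                                                  (λ i → g (toℕ i) * h (n ∸ toℕ i)))) ⟩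
  ∑[ i ≤ n ] ((f -ₛ g) (toℕ i) * h (n ∸ toℕ i) + g (toℕ i) * h (n ∸ toℕ i)) - (g *ₛ h) n
    ≡⟨ cong (_- (g *ₛ h) n) (sum-cong-≗ {suc n} (λ i → lemma₂ (f (toℕ i)) (g (toℕ i)) (h (n ∸ toℕ i)))) ⟩
  (f *ₛ h) n - (g *ₛ h) n ∎
  where
  open ≡-Reasoning
  lemma₁ : ∀ x y → x + y - y ≡ x
  lemma₁ = solve-∀
  lemma₂ : ∀ x y z → (x - y) * z + y * z ≡ x * z
  lemma₂ = solve-∀

*ₛ-vanishesʳ : ∀ {k} f g → VanishesBelow k g → VanishesBelow k (f *ₛ g)
*ₛ-vanishesʳ f g g≡0 {n} n<k = ∑-zero (suc n) λ i →
  trans (cong (f (toℕ i) *_) (g≡0 (ℕ.≤-<-trans (ℕ.m∸n≤m n (toℕ i)) n<k)))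
        (ℤ.*-zeroʳ (f (toℕ i)))

*ₛ-vanishes-suc : ∀ {k} f g → f 0 ≡ 0ℤ → VanishesBelow k g → VanishesBelow (suc k) (f *ₛ g)
*ₛ-vanishes-suc f g f₀≡0 g≡0 {zero} _ =
  trans (ℤ.+-identityʳ _) (cong (_* g 0) f₀≡0)
*ₛ-vanishes-suc f g f₀≡0 g≡0 {suc n} (s≤s n<k) =
  cong₂ _+_ (cong (_* g (suc n)) f₀≡0) (*ₛ-vanishesʳ (λ k → f (suc k)) g g≡0 n<k)

^ₛ-vanishes : ∀ f → f 0 ≡ 0ℤ → ∀ k → VanishesBelow k (f ^ₛ k)
^ₛ-vanishes f f₀≡0 zero    ()
^ₛ-vanishes f f₀≡0 (suc k) = *ₛ-vanishes-suc f (f ^ₛ k) f₀≡0 (^ₛ-vanishes f f₀≡0 k)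

inv-inverseʳ : ∀ g → g 0 ≡ 1ℤ → g *ₛ inv g ≈ₛ 1ₛ
inv-inverseʳ g g₀≡1 n = begin
  ∑[ i ≤ n ] (g (toℕ i) * inv g (n ∸ toℕ i))
    ≡⟨ sum-cong-≗ {suc n} (λ i → cong (g (toℕ i) *_)
         (∑-extend (λ k → (h ^ₛ k) (n ∸ toℕ i)) (ℕ.m∸n≤m n (toℕ i)) (λ {k} → ^ₛ-vanishes h h₀≡0 k))) ⟩
  ∑[ i ≤ n ] (g (toℕ i) * ∑[ k ≤ n ] (h ^ₛ toℕ k) (n ∸ toℕ i))
    ≡⟨ sum-cong-≗ {suc n} (λ i → *-distribˡ-sum {suc n} (g (toℕ i)) (λ k → (h ^ₛ toℕ k) (n ∸ toℕ i))) ⟩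
  ∑[ i ≤ n ] ∑[ k ≤ n ] (g (toℕ i) * (h ^ₛ toℕ k) (n ∸ toℕ i))
    ≡⟨ ∑-comm {suc n} {suc n} (λ i k → g (toℕ i) * (h ^ₛ toℕ k) (n ∸ toℕ i)) ⟩
  ∑[ k ≤ n ] (g *ₛ h ^ₛ toℕ k) n
    ≡⟨ sum-cong-≗ {suc n} (λ k → step (h ^ₛ toℕ k)) ⟩
  ∑[ k ≤ n ] ((h ^ₛ toℕ k) n - (h ^ₛ suc (toℕ k)) n)
    ≡⟨ ∑-telescope n (λ k → (h ^ₛ k) n) ⟩
  1ₛ n - (h ^ₛ suc n) n
    ≡⟨ cong (λ x → 1ₛ n - x) (^ₛ-vanishes h h₀≡0 (suc n) ℕ.≤-refl) ⟩
  1ₛ n - 0ℤ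
    ≡⟨ ℤ.+-identityʳ (1ₛ n) ⟩
  1ₛ n ∎
  where
  open ≡-Reasoning
  h = 1ₛ -ₛ g
  h₀≡0 : h 0 ≡ 0ℤ
  h₀≡0 = cong (λ x → 1ℤ - x) g₀≡1
  lemma : ∀ x y → y ≡ x - (x - y)
  lemma = solve-∀
  step : ∀ f → (g *ₛ f) n ≡ f n - (h *ₛ f) n
  step f = trans (lemma (f n) ((g *ₛ f) n))
    (cong (λ x → f n - x) (sym (trans (-ₛ-*ₛ-distribʳ 1ₛ g f n)
                               (cong (_- (g *ₛ f) n) (*ₛ-identityˡ f n)))))

⟪⨾⟫-stable : ∀ z w → w 0 ≡ 0ℤ → ∀ {n k} → n ℕ.< k → ⟪ z ⨾ w ⟫ k n ≡ ⟪ z ⨾ w ⟫∞ n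
⟪⨾⟫-stable z w w₀≡0 {n} n<k = go (ℕ.≤⇒≤′ n<k)
  where
  step : ∀ {k} → n ℕ.< k → ⟪ z ⨾ w ⟫ (suc k) n ≡ ⟪ z ⨾ w ⟫ k n
  step {k} n<k = trans
    (sum-cong-≗ {suc n} (λ i → cong (⟪ z ⨾ w ⟫ k (toℕ i) *_)
      (trans (cong (λ x → 1ₛ (n ∸ toℕ i) - x)
               (*ₛ-vanishesʳ z (w ^ₛ k) (^ₛ-vanishes w w₀≡0 k) (ℕ.≤-<-trans (ℕ.m∸n≤m n (toℕ i)) n<k)))
             (ℤ.+-identityʳ (1ₛ (n ∸ toℕ i))))))
    (*ₛ-identityʳ (⟪ z ⨾ w ⟫ k) n)
  go : ∀ {k} → suc n ℕ.≤′ k → ⟪ z ⨾ w ⟫ k n ≡ ⟪ z ⨾ w ⟫∞ n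
  go (ℕ.≤′-reflexive refl) = refl
  go (ℕ.≤′-step n<k)       = trans (step (ℕ.≤′⇒≤ n<k)) (go n<k)

⟪⨾⟫-constant : ∀ z w n → z 0 ≡ 0ℤ → ⟪ z ⨾ w ⟫ n 0 ≡ 1ℤ
⟪⨾⟫-constant z w zero    z₀≡0 = refl
⟪⨾⟫-constant z w (suc n) z₀≡0
  rewrite ⟪⨾⟫-constant z w n z₀≡0 | z₀≡0 = refl

{-# OPTIONS --safe #-}

-- For a = b + tm, splitting off the first t factors gives
-- (q^b;q^m)_∞ = (q^b;q^m)_t (q^a;q^m)_∞, and pairing the factors 1 + x and
-- 1 - x gives (-q^a;q^m)_∞ (q^a;q^m)_∞ = (q^{2a};q^{2m})_∞.  In the resulting
-- quotient the numerator is a product of factors 1 + q^c and the denominator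
-- a product of factors 1 - q^c, whose inverses are geometric series.
module Submission where

open import Defs
open import Data.Nat.Base using (ℕ; NonZero; _≤_; _+_; _*_)
open import Data.Integer.Base using (+_; _-_)
open import Data.Integer.Divisibility using (_∣_)
open import Data.Product.Base using (_×_)
open import Relation.Binary.PropositionalEquality.Core using (_≡_)

open import Algebra.Bundles using (CommutativeRing)
open import Data.Fin.Base using (Fin; zero; suc; toℕ)
open import Data.Fin.Properties using (toℕ≤pred[n])
open import Data.Integer.Base as ℤ using (ℤ; 0ℤ; 1ℤ)
import Data.Integer.Properties as ℤ
open import Data.Integer.Tactic.RingSolver using (solve-∀)
open import Data.Nat.Base using (zero; suc; _∸_; z≤n; s≤s)
open import Data.Nat.Divisibility using (divides)
import Data.Nat.Properties as ℕ
open import Data.Product.Base using (_,_; ∃-syntax)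
open import Relation.Binary.PropositionalEquality
  using (refl; sym; trans; cong; cong₂; subst; module ≡-Reasoning)
open import Algebra.Properties.Semiring.Sum ℤ.+-*-semiring using (sum; sum-cong-≗)

-- The commutative ring ℤ[[q]]

infixl 6 _+ₛ_

_+ₛ_ : Series → Series → Series
(f +ₛ g) n = f n ℤ.+ g n

0ₛ : Series
0ₛ _ = 0ℤ

tail : Series → Series
tail f n = f (suc n)

infix 4 _≈[_]_

-- Congruence modulo `q^(n+1)`. Since `inv` and `⟪_⨾_⟫∞` truncate differently at each coefficient,
-- finite identities reach them through this relation.
_≈[_]_ : Series → ℕ → Series → Set
f ≈[ n ] g = ∀ {k} → k ≤ n → f k ≡ g k

*ₛ-cong-≤ : ∀ {f f′ g g′} n → f ≈[ n ] f′ → g ≈[ n ] g′ → f *ₛ g ≈[ n ] f′ *ₛ g′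
*ₛ-cong-≤ n f≈f′ g≈g′ {k} k≤n = sum-cong-≗ {suc k} λ i →
  cong₂ ℤ._*_ (f≈f′ (ℕ.≤-trans (toℕ≤pred[n] i) k≤n))
              (g≈g′ (ℕ.≤-trans (ℕ.m∸n≤m k (toℕ i)) k≤n))

*ₛ-cong : ∀ {f f′ g g′} → f ≈ₛ f′ → g ≈ₛ g′ → f *ₛ g ≈ₛ f′ *ₛ g′
*ₛ-cong f≈f′ g≈g′ n = *ₛ-cong-≤ n (λ {k} _ → f≈f′ k) (λ {k} _ → g≈g′ k) ℕ.≤-refl

*ₛ-congˡ : ∀ f {g g′} → g ≈ₛ g′ → f *ₛ g ≈ₛ f *ₛ g′
*ₛ-congˡ f = *ₛ-cong {f} (λ _ → refl)

-- At `suc n` the convolution unfolds definitionally to its first summand plus `(tail f *ₛ h) n`, so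
-- induction on the coefficient passes to the tails of the left factors.
*ₛ-distribʳ-+ₛ : ∀ h f g → (f +ₛ g) *ₛ h ≈ₛ f *ₛ h +ₛ g *ₛ h
*ₛ-distribʳ-+ₛ h f g zero    = lemma (f 0) (g 0) (h 0)
  where
  lemma : ∀ x y z → (x ℤ.+ y) ℤ.* z ℤ.+ 0ℤ ≡ (x ℤ.* z ℤ.+ 0ℤ) ℤ.+ (y ℤ.* z ℤ.+ 0ℤ)
  lemma = solve-∀
*ₛ-distribʳ-+ₛ h f g (suc n) =
  trans (cong (ℤ._+_ ((f 0 ℤ.+ g 0) ℤ.* h (suc n))) (*ₛ-distribʳ-+ₛ h (tail f) (tail g) n))
        (lemma (f 0) (g 0) (h (suc n)) ((tail f *ₛ h) n) ((tail g *ₛ h) n))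
  where
  lemma : ∀ x y z u v → (x ℤ.+ y) ℤ.* z ℤ.+ (u ℤ.+ v) ≡ (x ℤ.* z ℤ.+ u) ℤ.+ (y ℤ.* z ℤ.+ v)
  lemma = solve-∀

*ₛ-scaleˡ : ∀ c f g n → ((λ k → c ℤ.* f k) *ₛ g) n ≡ c ℤ.* (f *ₛ g) n
*ₛ-scaleˡ c f g zero    = lemma c (f 0) (g 0)
  where
  lemma : ∀ c x y → c ℤ.* x ℤ.* y ℤ.+ 0ℤ ≡ c ℤ.* (x ℤ.* y ℤ.+ 0ℤ)
  lemma = solve-∀
*ₛ-scaleˡ c f g (suc n) =
  trans (cong (ℤ._+_ (c ℤ.* f 0 ℤ.* g (suc n))) (*ₛ-scaleˡ c (tail f) g n))
        (lemma c (f 0) (g (suc n)) ((tail f *ₛ g) n))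
  where
  lemma : ∀ c x y z → c ℤ.* x ℤ.* y ℤ.+ c ℤ.* z ≡ c ℤ.* (x ℤ.* y ℤ.+ z)
  lemma = solve-∀

-- Both sides are peeled along tail (f *ₛ g) = f 0 · tail g +ₛ tail f *ₛ g,
-- which holds definitionally.
*ₛ-assoc : ∀ f g h → (f *ₛ g) *ₛ h ≈ₛ f *ₛ (g *ₛ h)
*ₛ-assoc f g h zero    = lemma (f 0) (g 0) (h 0)
  where
  lemma : ∀ x y z → (x ℤ.* y ℤ.+ 0ℤ) ℤ.* z ℤ.+ 0ℤ ≡ x ℤ.* (y ℤ.* z ℤ.+ 0ℤ) ℤ.+ 0ℤ
  lemma = solve-∀
*ₛ-assoc f g h (suc n) = begin
  (f 0 ℤ.* g 0 ℤ.+ 0ℤ) ℤ.* h (suc n) ℤ.+ (tail (f *ₛ g) *ₛ h) n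
    ≡⟨ cong (ℤ._+_ ((f 0 ℤ.* g 0 ℤ.+ 0ℤ) ℤ.* h (suc n)))
         (trans (*ₛ-distribʳ-+ₛ h (λ k → f 0 ℤ.* g (suc k)) (tail f *ₛ g) n)
                (cong₂ ℤ._+_ (*ₛ-scaleˡ (f 0) (tail g) h n) (*ₛ-assoc (tail f) g h n))) ⟩
  (f 0 ℤ.* g 0 ℤ.+ 0ℤ) ℤ.* h (suc n) ℤ.+ (f 0 ℤ.* (tail g *ₛ h) n ℤ.+ (tail f *ₛ (g *ₛ h)) n)
    ≡⟨ lemma (f 0) (g 0) (h (suc n)) ((tail g *ₛ h) n) ((tail f *ₛ (g *ₛ h)) n) ⟩
  f 0 ℤ.* (g 0 ℤ.* h (suc n) ℤ.+ (tail g *ₛ h) n) ℤ.+ (tail f *ₛ (g *ₛ h)) n ∎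
  where
  open ≡-Reasoning
  lemma : ∀ x y z u v → (x ℤ.* y ℤ.+ 0ℤ) ℤ.* z ℤ.+ (x ℤ.* u ℤ.+ v) ≡ x ℤ.* (y ℤ.* z ℤ.+ u) ℤ.+ v
  lemma = solve-∀

-- The definition of `*ₛ` splits off the first summand; splitting off the last one instead is what
-- makes the induction for commutativity close.
*ₛ-sucʳ : ∀ f g n → (f *ₛ g) (suc n) ≡ (f *ₛ tail g) n ℤ.+ f (suc n) ℤ.* g 0
*ₛ-sucʳ f g zero    = lemma (f 0) (g 1) (f 1 ℤ.* g 0)
  where
  lemma : ∀ x y z → x ℤ.* y ℤ.+ (z ℤ.+ 0ℤ) ≡ (x ℤ.* y ℤ.+ 0ℤ) ℤ.+ z
  lemma = solve-∀
*ₛ-sucʳ f g (suc n) =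
  trans (cong (ℤ._+_ (f 0 ℤ.* g (suc (suc n)))) (*ₛ-sucʳ (tail f) g n))
        (sym (ℤ.+-assoc (f 0 ℤ.* g (suc (suc n))) ((tail f *ₛ tail g) n) _))

*ₛ-comm : ∀ f g → f *ₛ g ≈ₛ g *ₛ f
*ₛ-comm f g zero    = cong (ℤ._+ 0ℤ) (ℤ.*-comm (f 0) (g 0))
*ₛ-comm f g (suc n) = begin
  f 0 ℤ.* g (suc n) ℤ.+ (tail f *ₛ g) n
    ≡⟨ cong₂ ℤ._+_ (ℤ.*-comm (f 0) (g (suc n))) (*ₛ-comm (tail f) g n) ⟩
  g (suc n) ℤ.* f 0 ℤ.+ (g *ₛ tail f) n
    ≡⟨ ℤ.+-comm (g (suc n) ℤ.* f 0) ((g *ₛ tail f) n) ⟩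
  (g *ₛ tail f) n ℤ.+ g (suc n) ℤ.* f 0
    ≡⟨ sym (*ₛ-sucʳ g f n) ⟩
  (g *ₛ f) (suc n) ∎
  where open ≡-Reasoning

*ₛ-distribˡ-+ₛ : ∀ h f g → h *ₛ (f +ₛ g) ≈ₛ h *ₛ f +ₛ h *ₛ g
*ₛ-distribˡ-+ₛ h f g n =
  trans (*ₛ-comm h (f +ₛ g) n)
        (trans (*ₛ-distribʳ-+ₛ h f g n) (cong₂ ℤ._+_ (*ₛ-comm f h n) (*ₛ-comm g h n)))

seriesRing : CommutativeRing _ _
seriesRing = record
  { Carrier = Series
  ; _≈_     = _≈ₛ_
  ; _+_     = _+ₛ_
  ; _*_     = _*ₛ_
  ; -_      = -ₛ_
  ; 0#      = 0ₛ
  ; 1#      = 1ₛ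
  ; isCommutativeRing = record
    { isRing = record
      { +-isAbelianGroup = record
        { isGroup = record
          { isMonoid = record
            { isSemigroup = record
              { isMagma = record
                { isEquivalence = record
                  { refl  = λ _ → refl
                  ; sym   = λ f≈g n → sym (f≈g n)
                  ; trans = λ f≈g g≈h n → trans (f≈g n) (g≈h n)
                  }
                ; ∙-cong = λ f≈f′ g≈g′ n → cong₂ ℤ._+_ (f≈f′ n) (g≈g′ n)
                }
              ; assoc = λ f g h n → ℤ.+-assoc (f n) (g n) (h n)
              }
            ; identity = (λ f n → ℤ.+-identityˡ (f n)) , (λ f n → ℤ.+-identityʳ (f n))
            }
          ; inverse = (λ f n → ℤ.+-inverseˡ (f n)) , (λ f n → ℤ.+-inverseʳ (f n))
          ; ⁻¹-cong = λ f≈g n → cong ℤ.-_ (f≈g n)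
          }
        ; comm = λ f g n → ℤ.+-comm (f n) (g n)
        }
      ; *-cong     = *ₛ-cong
      ; *-assoc    = *ₛ-assoc
      ; *-identity = *ₛ-identityˡ , *ₛ-identityʳ
      ; distrib    = *ₛ-distribˡ-+ₛ , *ₛ-distribʳ-+ₛ
      }
    ; *-comm = *ₛ-comm
    }
  }

open CommutativeRing seriesRing using (setoid; ring; *-commutativeSemigroup)
  renaming (refl to ≈ₛ-refl; sym to ≈ₛ-sym; trans to ≈ₛ-trans)

open import Relation.Binary.Reasoning.Setoid setoid

open import Algebra.Properties.CommutativeSemigroup *-commutativeSemigroup
  using (interchange; x∙yz≈y∙xz; x∙yz≈xz∙y; x∙yz≈yx∙z)
open import Algebra.Properties.Ring ring using (-‿distribˡ-*; -‿involutive)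

-- Powers

^ₛ-congˡ : ∀ {f g} n → f ≈ₛ g → f ^ₛ n ≈ₛ g ^ₛ n
^ₛ-congˡ zero    f≈g = ≈ₛ-refl
^ₛ-congˡ (suc n) f≈g = *ₛ-cong f≈g (^ₛ-congˡ n f≈g)

^ₛ-cong-≤ : ∀ {f g} n → f ≈[ n ] g → ∀ k → f ^ₛ k ≈[ n ] g ^ₛ k
^ₛ-cong-≤ n f≈g zero    = λ _ → refl
^ₛ-cong-≤ n f≈g (suc k) = *ₛ-cong-≤ n f≈g (^ₛ-cong-≤ n f≈g k)

^ₛ-+ : ∀ f m n → f ^ₛ (m + n) ≈ₛ f ^ₛ m *ₛ f ^ₛ n
^ₛ-+ f zero    n = ≈ₛ-sym (*ₛ-identityˡ (f ^ₛ n))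
^ₛ-+ f (suc m) n = ≈ₛ-trans (*ₛ-congˡ f (^ₛ-+ f m n))
                            (≈ₛ-sym (*ₛ-assoc f (f ^ₛ m) (f ^ₛ n)))

^ₛ-* : ∀ f m n → (f ^ₛ m) ^ₛ n ≈ₛ f ^ₛ (n * m)
^ₛ-* f m zero    = ≈ₛ-refl
^ₛ-* f m (suc n) = ≈ₛ-trans (*ₛ-congˡ (f ^ₛ m) (^ₛ-* f m n))
                            (≈ₛ-sym (^ₛ-+ f m (n * m)))

^ₛ-double : ∀ f n → f ^ₛ (2 * n) ≈ₛ f ^ₛ n *ₛ f ^ₛ n
^ₛ-double f n rewrite ℕ.+-identityʳ n = ^ₛ-+ f n n

^ₛ-distrib-*ₛ : ∀ f g n → (f *ₛ g) ^ₛ n ≈ₛ f ^ₛ n *ₛ g ^ₛ n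
^ₛ-distrib-*ₛ f g zero    = ≈ₛ-sym (*ₛ-identityˡ 1ₛ)
^ₛ-distrib-*ₛ f g (suc n) =
  ≈ₛ-trans (*ₛ-congˡ (f *ₛ g) (^ₛ-distrib-*ₛ f g n))
           (interchange f g (f ^ₛ n) (g ^ₛ n))

-- Inverses

inv-cong-≤ : ∀ {f g} n → f ≈[ n ] g → inv f ≈[ n ] inv g
inv-cong-≤ n f≈g {k} k≤n = sum-cong-≗ {suc k} λ i →
  ^ₛ-cong-≤ n (λ {j} j≤n → cong (ℤ._-_ (1ₛ j)) (f≈g j≤n)) (toℕ i) k≤n

inv-cong : ∀ {f g} → f ≈ₛ g → inv f ≈ₛ inv g
inv-cong f≈g n = inv-cong-≤ n (λ {k} _ → f≈g k) ℕ.≤-refl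

*ₛ-constant : ∀ f g → f 0 ≡ 1ℤ → g 0 ≡ 1ℤ → (f *ₛ g) 0 ≡ 1ℤ
*ₛ-constant f g f₀≡1 g₀≡1 rewrite f₀≡1 | g₀≡1 = refl

-- Uniqueness of inverses: insert `1ₛ` as `(f *ₛ inv f) *ₛ (g *ₛ inv g)` and regroup so that
-- `f *ₛ g` cancels against its own inverse.
inv-*ₛ : ∀ f g → f 0 ≡ 1ℤ → g 0 ≡ 1ℤ → inv (f *ₛ g) ≈ₛ inv f *ₛ inv g
inv-*ₛ f g f₀≡1 g₀≡1 = begin
  inv (f *ₛ g)
    ≈⟨ *ₛ-identityʳ (inv (f *ₛ g)) ⟨
  inv (f *ₛ g) *ₛ 1ₛ
    ≈⟨ *ₛ-congˡ (inv (f *ₛ g)) (*ₛ-identityˡ 1ₛ) ⟨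
  inv (f *ₛ g) *ₛ (1ₛ *ₛ 1ₛ)
    ≈⟨ *ₛ-congˡ (inv (f *ₛ g))
         (*ₛ-cong (inv-inverseʳ f f₀≡1) (inv-inverseʳ g g₀≡1)) ⟨
  inv (f *ₛ g) *ₛ ((f *ₛ inv f) *ₛ (g *ₛ inv g))
    ≈⟨ *ₛ-congˡ (inv (f *ₛ g)) (interchange f (inv f) g (inv g)) ⟩
  inv (f *ₛ g) *ₛ ((f *ₛ g) *ₛ (inv f *ₛ inv g))
    ≈⟨ x∙yz≈yx∙z (inv (f *ₛ g)) (f *ₛ g) (inv f *ₛ inv g) ⟩
  ((f *ₛ g) *ₛ inv (f *ₛ g)) *ₛ (inv f *ₛ inv g)
    ≈⟨ *ₛ-cong {g = inv f *ₛ inv g}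
         (inv-inverseʳ (f *ₛ g) (*ₛ-constant f g f₀≡1 g₀≡1)) (λ _ → refl) ⟩
  1ₛ *ₛ (inv f *ₛ inv g)
    ≈⟨ *ₛ-identityˡ (inv f *ₛ inv g) ⟩
  inv f *ₛ inv g ∎

-- q-Pochhammer symbols

1-zw-cong : ∀ {z z′ w w′} → z ≈ₛ z′ → w ≈ₛ w′ → 1ₛ -ₛ z *ₛ w ≈ₛ 1ₛ -ₛ z′ *ₛ w′
1-zw-cong z≈z′ w≈w′ n = cong (ℤ._-_ (1ₛ n)) (*ₛ-cong z≈z′ w≈w′ n)

⟪⨾⟫-cong : ∀ {z z′ w w′} → z ≈ₛ z′ → w ≈ₛ w′ → ∀ n → ⟪ z ⨾ w ⟫ n ≈ₛ ⟪ z′ ⨾ w′ ⟫ n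
⟪⨾⟫-cong z≈z′ w≈w′ zero    = ≈ₛ-refl
⟪⨾⟫-cong z≈z′ w≈w′ (suc n) =
  *ₛ-cong (⟪⨾⟫-cong z≈z′ w≈w′ n) (1-zw-cong z≈z′ (^ₛ-congˡ n w≈w′))

⟪⨾⟫∞-cong : ∀ {z z′ w w′} → z ≈ₛ z′ → w ≈ₛ w′ → ⟪ z ⨾ w ⟫∞ ≈ₛ ⟪ z′ ⨾ w′ ⟫∞
⟪⨾⟫∞-cong z≈z′ w≈w′ n = ⟪⨾⟫-cong z≈z′ w≈w′ (suc n) n

⟪⨾⟫∞-truncate : ∀ z w → w 0 ≡ 0ℤ → ∀ n → ⟪ z ⨾ w ⟫∞ ≈[ n ] ⟪ z ⨾ w ⟫ (suc n)
⟪⨾⟫∞-truncate z w w₀≡0 n k≤n = sym (⟪⨾⟫-stable z w w₀≡0 (s≤s k≤n))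

-- The count is `n + t` so that it reduces at `suc n` and exposes the last factor, whose power
-- `w^(n+t)` is then shared between the shifted start and the base.
⟪⨾⟫-split : ∀ z w t n → ⟪ z ⨾ w ⟫ (n + t) ≈ₛ ⟪ z ⨾ w ⟫ t *ₛ ⟪ z *ₛ w ^ₛ t ⨾ w ⟫ n
⟪⨾⟫-split z w t zero    = ≈ₛ-sym (*ₛ-identityʳ (⟪ z ⨾ w ⟫ t))
⟪⨾⟫-split z w t (suc n) = begin
  ⟪ z ⨾ w ⟫ (n + t) *ₛ (1ₛ -ₛ z *ₛ w ^ₛ (n + t))
    ≈⟨ *ₛ-cong (⟪⨾⟫-split z w t n) factor ⟩
  (⟪ z ⨾ w ⟫ t *ₛ ⟪ z *ₛ w ^ₛ t ⨾ w ⟫ n) *ₛ (1ₛ -ₛ (z *ₛ w ^ₛ t) *ₛ w ^ₛ n)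
    ≈⟨ *ₛ-assoc (⟪ z ⨾ w ⟫ t) (⟪ z *ₛ w ^ₛ t ⨾ w ⟫ n) _ ⟩
  ⟪ z ⨾ w ⟫ t *ₛ ⟪ z *ₛ w ^ₛ t ⨾ w ⟫ (suc n) ∎
  where
  factor : 1ₛ -ₛ z *ₛ w ^ₛ (n + t) ≈ₛ 1ₛ -ₛ (z *ₛ w ^ₛ t) *ₛ w ^ₛ n
  factor k = cong (ℤ._-_ (1ₛ k))
    (≈ₛ-trans (*ₛ-congˡ z (^ₛ-+ w n t)) (x∙yz≈xz∙y z (w ^ₛ n) (w ^ₛ t)) k)

⟪⨾⟫∞-split : ∀ z w → w 0 ≡ 0ℤ → ∀ t →
             ⟪ z ⨾ w ⟫∞ ≈ₛ ⟪ z ⨾ w ⟫ t *ₛ ⟪ z *ₛ w ^ₛ t ⨾ w ⟫∞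
⟪⨾⟫∞-split z w w₀≡0 t n =
  -- Taking `suc n + t` factors leaves exactly `suc n` after the split, enough to determine the
  -- shifted infinite product up to degree `n`.
  trans (sym (⟪⨾⟫-stable z w w₀≡0 (ℕ.m≤m+n (suc n) t)))
        (trans (⟪⨾⟫-split z w t (suc n) n)
               (sym (*ₛ-cong-≤ {⟪ z ⨾ w ⟫ t} n (λ _ → refl)
                      (⟪⨾⟫∞-truncate (z *ₛ w ^ₛ t) w w₀≡0 n) ℕ.≤-refl)))

1--zw : ∀ z w → 1ₛ -ₛ (-ₛ z) *ₛ w ≈ₛ 1ₛ +ₛ z *ₛ w
1--zw z w n = cong (ℤ._+_ (1ₛ n))
  (trans (cong ℤ.-_ (sym (-‿distribˡ-* z w n))) (-‿involutive (z *ₛ w) n))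

1-ₛ-*ₛ-1+ₛ : ∀ f → (1ₛ -ₛ f) *ₛ (1ₛ +ₛ f) ≈ₛ 1ₛ -ₛ f *ₛ f
1-ₛ-*ₛ-1+ₛ f n = trans (-ₛ-*ₛ-distribʳ 1ₛ f (1ₛ +ₛ f) n)
  (trans (cong₂ ℤ._-_ (*ₛ-identityˡ (1ₛ +ₛ f) n)
                (trans (*ₛ-distribˡ-+ₛ f 1ₛ f n) (cong (ℤ._+ (f *ₛ f) n) (*ₛ-identityʳ f n))))
         (lemma (1ₛ n) (f n) ((f *ₛ f) n)))
  where
  lemma : ∀ x y z → x ℤ.+ y ℤ.- (y ℤ.+ z) ≡ x ℤ.- z
  lemma = solve-∀

-- Difference of squares, factor by factor, with `(z w^i)^2 = z^2 (w^2)^i`.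
⟪⨾⟫-pair : ∀ z w n → ⟪ -ₛ z ⨾ w ⟫ n *ₛ ⟪ z ⨾ w ⟫ n ≈ₛ ⟪ z *ₛ z ⨾ w *ₛ w ⟫ n
⟪⨾⟫-pair z w zero    = *ₛ-identityˡ 1ₛ
⟪⨾⟫-pair z w (suc n) = begin
  (⟪ -ₛ z ⨾ w ⟫ n *ₛ (1ₛ -ₛ (-ₛ z) *ₛ w ^ₛ n)) *ₛ (⟪ z ⨾ w ⟫ n *ₛ (1ₛ -ₛ z *ₛ w ^ₛ n))
    ≈⟨ interchange (⟪ -ₛ z ⨾ w ⟫ n) (1ₛ -ₛ (-ₛ z) *ₛ w ^ₛ n) (⟪ z ⨾ w ⟫ n) (1ₛ -ₛ z *ₛ w ^ₛ n) ⟩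
  (⟪ -ₛ z ⨾ w ⟫ n *ₛ ⟪ z ⨾ w ⟫ n) *ₛ ((1ₛ -ₛ (-ₛ z) *ₛ w ^ₛ n) *ₛ (1ₛ -ₛ z *ₛ w ^ₛ n))
    ≈⟨ *ₛ-cong (⟪⨾⟫-pair z w n) factor ⟩
  ⟪ z *ₛ z ⨾ w *ₛ w ⟫ (suc n) ∎
  where
  factor : (1ₛ -ₛ (-ₛ z) *ₛ w ^ₛ n) *ₛ (1ₛ -ₛ z *ₛ w ^ₛ n) ≈ₛ 1ₛ -ₛ (z *ₛ z) *ₛ (w *ₛ w) ^ₛ n
  factor = begin
    (1ₛ -ₛ (-ₛ z) *ₛ w ^ₛ n) *ₛ (1ₛ -ₛ z *ₛ w ^ₛ n)
      ≈⟨ *ₛ-comm (1ₛ -ₛ (-ₛ z) *ₛ w ^ₛ n) (1ₛ -ₛ z *ₛ w ^ₛ n) ⟩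
    (1ₛ -ₛ z *ₛ w ^ₛ n) *ₛ (1ₛ -ₛ (-ₛ z) *ₛ w ^ₛ n)
      ≈⟨ *ₛ-congˡ (1ₛ -ₛ z *ₛ w ^ₛ n) (1--zw z (w ^ₛ n)) ⟩
    (1ₛ -ₛ z *ₛ w ^ₛ n) *ₛ (1ₛ +ₛ z *ₛ w ^ₛ n)
      ≈⟨ 1-ₛ-*ₛ-1+ₛ (z *ₛ w ^ₛ n) ⟩
    1ₛ -ₛ (z *ₛ w ^ₛ n) *ₛ (z *ₛ w ^ₛ n)
      ≈⟨ (λ k → cong (ℤ._-_ (1ₛ k)) (≈ₛ-trans (interchange z (w ^ₛ n) z (w ^ₛ n))
                                     (*ₛ-congˡ (z *ₛ z) (≈ₛ-sym (^ₛ-distrib-*ₛ w w n))) k)) ⟩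
    1ₛ -ₛ (z *ₛ z) *ₛ (w *ₛ w) ^ₛ n ∎

⟪⨾⟫∞-pair : ∀ z w → w 0 ≡ 0ℤ →
            ⟪ -ₛ z ⨾ w ⟫∞ *ₛ ⟪ z ⨾ w ⟫∞ ≈ₛ ⟪ z *ₛ z ⨾ w *ₛ w ⟫∞
⟪⨾⟫∞-pair z w w₀≡0 n =
  trans (*ₛ-cong-≤ n (⟪⨾⟫∞-truncate (-ₛ z) w w₀≡0 n) (⟪⨾⟫∞-truncate z w w₀≡0 n) ℕ.≤-refl)
        -- By definition the coefficient of the right-hand side at `n` is already that of its
        -- partial product with `suc n` factors.
        (⟪⨾⟫-pair z w (suc n) n)

-- Non-negativity

sum-nonneg : ∀ n {t : Fin n → ℤ} → (∀ i → 0ℤ ℤ.≤ t i) → 0ℤ ℤ.≤ sum t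
sum-nonneg zero    t≥0 = ℤ.≤-refl
sum-nonneg (suc n) t≥0 = ℤ.+-mono-≤ (t≥0 zero) (sum-nonneg n (λ i → t≥0 (suc i)))

*-nonneg : ∀ {x y} → 0ℤ ℤ.≤ x → 0ℤ ℤ.≤ y → 0ℤ ℤ.≤ x ℤ.* y
*-nonneg {x} {y} x≥0 y≥0 =
  subst (ℤ._≤ x ℤ.* y) (ℤ.*-zeroʳ x) (ℤ.*-monoˡ-≤-nonNeg x {{ℤ.nonNegative x≥0}} y≥0)

∈ℕ₀-resp-≈ₛ : ∀ {f g} → f ≈ₛ g → g ∈ℕ₀⟦q⟧ → f ∈ℕ₀⟦q⟧
∈ℕ₀-resp-≈ₛ f≈g g≥0 n = subst (0ℤ ℤ.≤_) (sym (f≈g n)) (g≥0 n)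

1ₛ∈ℕ₀ : 1ₛ ∈ℕ₀⟦q⟧
1ₛ∈ℕ₀ zero    = ℤ.+≤+ z≤n
1ₛ∈ℕ₀ (suc n) = ℤ.≤-refl

q∈ℕ₀ : q ∈ℕ₀⟦q⟧
q∈ℕ₀ 0             = ℤ.≤-refl
q∈ℕ₀ 1             = ℤ.+≤+ z≤n
q∈ℕ₀ (suc (suc n)) = ℤ.≤-refl

*ₛ∈ℕ₀ : ∀ {f g} → f ∈ℕ₀⟦q⟧ → g ∈ℕ₀⟦q⟧ → f *ₛ g ∈ℕ₀⟦q⟧
*ₛ∈ℕ₀ f≥0 g≥0 n = sum-nonneg (suc n) λ i → *-nonneg (f≥0 (toℕ i)) (g≥0 (n ∸ toℕ i))

^ₛ∈ℕ₀ : ∀ {f} → f ∈ℕ₀⟦q⟧ → ∀ n → f ^ₛ n ∈ℕ₀⟦q⟧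
^ₛ∈ℕ₀ f≥0 zero    = 1ₛ∈ℕ₀
^ₛ∈ℕ₀ f≥0 (suc n) = *ₛ∈ℕ₀ f≥0 (^ₛ∈ℕ₀ f≥0 n)

-- `inv g` is defined by truncated sums of powers of `1ₛ -ₛ g`, so its signs can be read off
-- directly.
inv∈ℕ₀ : ∀ {g} → 1ₛ -ₛ g ∈ℕ₀⟦q⟧ → inv g ∈ℕ₀⟦q⟧
inv∈ℕ₀ 1-g≥0 n = sum-nonneg (suc n) λ k → ^ₛ∈ℕ₀ 1-g≥0 (toℕ k) n

inv[1-f]∈ℕ₀ : ∀ {f} → f ∈ℕ₀⟦q⟧ → inv (1ₛ -ₛ f) ∈ℕ₀⟦q⟧
inv[1-f]∈ℕ₀ {f} f≥0 = inv∈ℕ₀ (∈ℕ₀-resp-≈ₛ (λ n → lemma (1ₛ n) (f n)) f≥0)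
  where
  lemma : ∀ x y → x ℤ.- (x ℤ.- y) ≡ y
  lemma = solve-∀

⟪-⨾⟫∈ℕ₀ : ∀ {z w} → z ∈ℕ₀⟦q⟧ → w ∈ℕ₀⟦q⟧ → ∀ n → ⟪ -ₛ z ⨾ w ⟫ n ∈ℕ₀⟦q⟧
⟪-⨾⟫∈ℕ₀         z≥0 w≥0 zero    = 1ₛ∈ℕ₀
⟪-⨾⟫∈ℕ₀ {z} {w} z≥0 w≥0 (suc n) = *ₛ∈ℕ₀ (⟪-⨾⟫∈ℕ₀ z≥0 w≥0 n)
  (∈ℕ₀-resp-≈ₛ (1--zw z (w ^ₛ n))
    (λ k → ℤ.+-mono-≤ (1ₛ∈ℕ₀ k) (*ₛ∈ℕ₀ z≥0 (^ₛ∈ℕ₀ w≥0 n) k)))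

-- For a product of several factors, `1ₛ` minus the product can have negative coefficients, so
-- `inv∈ℕ₀` is applied to one factor at a time; `z 0 ≡ 0ℤ` gives the constant terms 1 that `inv-*ₛ`
-- asks for.
inv⟪⨾⟫∈ℕ₀ : ∀ {z w} → z 0 ≡ 0ℤ → z ∈ℕ₀⟦q⟧ → w ∈ℕ₀⟦q⟧ → ∀ n → inv (⟪ z ⨾ w ⟫ n) ∈ℕ₀⟦q⟧
inv⟪⨾⟫∈ℕ₀         z₀≡0 z≥0 w≥0 zero    = inv∈ℕ₀ (λ n → ℤ.≤-reflexive (sym (ℤ.+-inverseʳ (1ₛ n))))
inv⟪⨾⟫∈ℕ₀ {z} {w} z₀≡0 z≥0 w≥0 (suc n) =
  ∈ℕ₀-resp-≈ₛ
    (inv-*ₛ (⟪ z ⨾ w ⟫ n) (1ₛ -ₛ z *ₛ w ^ₛ n) (⟪⨾⟫-constant z w n z₀≡0) constant)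
    (*ₛ∈ℕ₀ (inv⟪⨾⟫∈ℕ₀ z₀≡0 z≥0 w≥0 n) (inv[1-f]∈ℕ₀ (*ₛ∈ℕ₀ z≥0 (^ₛ∈ℕ₀ w≥0 n))))
  where
  constant : (1ₛ -ₛ z *ₛ w ^ₛ n) 0 ≡ 1ℤ
  constant rewrite z₀≡0 = refl

inv⟪⨾⟫∞∈ℕ₀ : ∀ {z w} → z 0 ≡ 0ℤ → w 0 ≡ 0ℤ → z ∈ℕ₀⟦q⟧ → w ∈ℕ₀⟦q⟧ → inv ⟪ z ⨾ w ⟫∞ ∈ℕ₀⟦q⟧
inv⟪⨾⟫∞∈ℕ₀ {z} {w} z₀≡0 w₀≡0 z≥0 w≥0 n =
  -- The coefficient of an inverse at `n` depends only on coefficients up to `n`, so the infinite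
  -- product may be replaced by a finite one.
  subst (0ℤ ℤ.≤_) (sym (inv-cong-≤ n (⟪⨾⟫∞-truncate z w w₀≡0 n) ℕ.≤-refl))
        (inv⟪⨾⟫∈ℕ₀ z₀≡0 z≥0 w≥0 (suc n) n)

-- Powers of `q`, the denominator of `F`, and the theorem

q^-constant : ∀ n .{{_ : NonZero n}} → (q ^ₛ n) 0 ≡ 0ℤ
q^-constant (suc n) = refl

q^∈ℕ₀ : ∀ n → q ^ₛ n ∈ℕ₀⟦q⟧
q^∈ℕ₀ = ^ₛ∈ℕ₀ q∈ℕ₀

denominator-≈ : ∀ a b m t .{{_ : NonZero m}} → a ≡ b + t * m →
  ⟪ -ₛ q ^ₛ a ⨾ q ^ₛ m ⟫∞ *ₛ ⟪ q ^ₛ b ⨾ q ^ₛ m ⟫∞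
    ≈ₛ ⟪ q ^ₛ b ⨾ q ^ₛ m ⟫ t *ₛ ⟪ q ^ₛ (2 * a) ⨾ q ^ₛ (2 * m) ⟫∞
denominator-≈ a b m t a≡b+tm = begin
  A *ₛ ⟪ q ^ₛ b ⨾ q ^ₛ m ⟫∞
    ≈⟨ *ₛ-congˡ A (⟪⨾⟫∞-split (q ^ₛ b) (q ^ₛ m) (q^-constant m) t) ⟩
  A *ₛ (B *ₛ ⟪ q ^ₛ b *ₛ (q ^ₛ m) ^ₛ t ⨾ q ^ₛ m ⟫∞)
    ≈⟨ *ₛ-congˡ A (*ₛ-congˡ B (⟪⨾⟫∞-cong shift (≈ₛ-refl {q ^ₛ m}))) ⟩
  A *ₛ (B *ₛ ⟪ q ^ₛ a ⨾ q ^ₛ m ⟫∞)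
    -- The finite product moves out, bringing together the two infinite products that start at
    -- `-ₛ q ^ₛ a` and `q ^ₛ a`.
    ≈⟨ x∙yz≈y∙xz A B ⟪ q ^ₛ a ⨾ q ^ₛ m ⟫∞ ⟩
  B *ₛ (A *ₛ ⟪ q ^ₛ a ⨾ q ^ₛ m ⟫∞)
    ≈⟨ *ₛ-congˡ B (⟪⨾⟫∞-pair (q ^ₛ a) (q ^ₛ m) (q^-constant m)) ⟩
  B *ₛ ⟪ q ^ₛ a *ₛ q ^ₛ a ⨾ q ^ₛ m *ₛ q ^ₛ m ⟫∞
    ≈⟨ *ₛ-congˡ B (⟪⨾⟫∞-cong (^ₛ-double q a) (^ₛ-double q m)) ⟨
  B *ₛ ⟪ q ^ₛ (2 * a) ⨾ q ^ₛ (2 * m) ⟫∞ ∎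
  where
  A = ⟪ -ₛ q ^ₛ a ⨾ q ^ₛ m ⟫∞
  B = ⟪ q ^ₛ b ⨾ q ^ₛ m ⟫ t
  shift : q ^ₛ b *ₛ (q ^ₛ m) ^ₛ t ≈ₛ q ^ₛ a
  shift rewrite a≡b+tm =
    ≈ₛ-trans (*ₛ-congˡ (q ^ₛ b) (^ₛ-* q m t)) (≈ₛ-sym (^ₛ-+ q b (t * m)))

-- Integer divisibility is divisibility of absolute values in the naturals; `b ≤ a` turns the
-- absolute value of the difference into `a ∸ b`, so the quotient is the required `t`.
∣-⇒≡+* : ∀ {a b m} → b ≤ a → + m ∣ + a - + b → ∃[ t ] a ≡ b + t * m
∣-⇒≡+* {a} {b} b≤a (divides t ∣a-b∣≡tm) = t ,
  trans (sym (ℕ.m+[n∸m]≡n b≤a)) (cong (λ x → b + x)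
    (trans (sym (cong ℤ.∣_∣ (trans (ℤ.m-n≡m⊖n a b) (ℤ.⊖-≥ b≤a)))) ∣a-b∣≡tm))

theorem1p6 : ∀ (a b m : ℕ) .{{_ : NonZero a}} .{{_ : NonZero b}} .{{_ : NonZero m}} →
    b ≤ a →
    (+ m ∣ + a - + b → F a b m ∈ℕ₀⟦q⟧)
    ×
    (∀ (t : ℕ) → a ≡ b + t * m →
    (F a b m ≈ₛ ⟪ -ₛ q ^ₛ (a + b) ⨾ q ^ₛ m ⟫∞
    /ₛ (⟪ q ^ₛ b ⨾ q ^ₛ m ⟫ t *ₛ ⟪ q ^ₛ (2 * a) ⨾ q ^ₛ (2 * m) ⟫∞))
    ×
    (⟪ -ₛ q ^ₛ (a + b) ⨾ q ^ₛ m ⟫∞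
    /ₛ (⟪ q ^ₛ b ⨾ q ^ₛ m ⟫ t *ₛ ⟪ q ^ₛ (2 * a) ⨾ q ^ₛ (2 * m) ⟫∞)) ∈ℕ₀⟦q⟧)
theorem1p6 a b m b≤a =
  -- The congruence case reduces to the explicit formula, with `t` the quotient of `a - b` by `m`.
  (λ m∣a-b → let t , a≡b+tm = ∣-⇒≡+* b≤a m∣a-b in
             ∈ℕ₀-resp-≈ₛ (identity t a≡b+tm) (nonneg t)) ,
  (λ t a≡b+tm → identity t a≡b+tm , nonneg t)
  where
  N = ⟪ -ₛ q ^ₛ (a + b) ⨾ q ^ₛ m ⟫∞
  D : ℕ → Series
  D t = ⟪ q ^ₛ b ⨾ q ^ₛ m ⟫ t *ₛ ⟪ q ^ₛ (2 * a) ⨾ q ^ₛ (2 * m) ⟫∞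

  identity : ∀ t → a ≡ b + t * m → F a b m ≈ₛ N /ₛ D t
  identity t a≡b+tm =
    *ₛ-congˡ N (inv-cong (denominator-≈ a b m t a≡b+tm))

  q^2a-constant = q^-constant (2 * a) {{ℕ.m*n≢0 2 a}}
  q^2m-constant = q^-constant (2 * m) {{ℕ.m*n≢0 2 m}}

  nonneg : ∀ t → N /ₛ D t ∈ℕ₀⟦q⟧
  nonneg t = *ₛ∈ℕ₀
    (λ n → ⟪-⨾⟫∈ℕ₀ (q^∈ℕ₀ (a + b)) (q^∈ℕ₀ m) (suc n) n)
    (∈ℕ₀-resp-≈ₛ
      (inv-*ₛ (⟪ q ^ₛ b ⨾ q ^ₛ m ⟫ t) ⟪ q ^ₛ (2 * a) ⨾ q ^ₛ (2 * m) ⟫∞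
        (⟪⨾⟫-constant (q ^ₛ b) (q ^ₛ m) t (q^-constant b))
        -- The count is 1 because the constant term of `⟪_⨾_⟫∞` is by definition that of the
        -- one-factor product.
        (⟪⨾⟫-constant (q ^ₛ (2 * a)) (q ^ₛ (2 * m)) 1 q^2a-constant))
      (*ₛ∈ℕ₀ (inv⟪⨾⟫∈ℕ₀ (q^-constant b) (q^∈ℕ₀ b) (q^∈ℕ₀ m) t)
             (inv⟪⨾⟫∞∈ℕ₀ q^2a-constant q^2m-constant (q^∈ℕ₀ (2 * a)) (q^∈ℕ₀ (2 * m)))))
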